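{- For every integer $q\ge2$ there exists a constant $c_6>0$ depending only on $q$ such that for every positive integer $k$ there exists a positive integer $n\le \exp(c_6k)$ with $s_q(kn)=k$. Consequently, for every $k\ge1$ the number $a_k$ (in base $q$) exists and $a_k=\exp(O_q(k))$.
   Context: For an integer base $q\ge2$, $s_q(m)$ denotes the sum of the base-$q$ digits of the nonnegative integer $m$, and $a_k$ denotes the smallest positive multiple of $k$ with $s_q(a_k)=k$. -}

module Defs where

open import Algebra.Definitions.RawSemiring using (_^_)
open import Data.Digit using (toDigits)
open import Data.Fin.Base using (toℕ)
open import Data.Integer.Base using (+_)
open import Data.List.Base using (map)
open import Data.Nat.Base as ℕ using (ℕ; zero; suc; _!)
open import Data.Nat.Divisibility.Core using (_∣_)
open import Data.Nat.ListAction using (sum)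
open import Data.Nat.Properties using (_!≢0)
open import Data.Product.Base using (_×_; ∃-syntax; proj₁)
open import Data.Rational.Base
  using (ℚ; 0ℚ; _/_; _+_; _-_; _*_; _≤_; _<_; ∣_∣; +-*-rawSemiring)
open import Relation.Binary.PropositionalEquality using (_≡_)
open import Relation.Nullary.Decidable using (fromWitness)

digitSum : (q : ℕ) → 2 ℕ.≤ q → ℕ → ℕ
digitSum q 2≤q m = sum (map toℕ (proj₁ (toDigits q {fromWitness 2≤q} m)))

module _ (q : ℕ) (2≤q : 2 ℕ.≤ q) (k : ℕ) where

  IsCandidate : ℕ → Set
  IsCandidate a = 1 ℕ.≤ a × k ∣ a × digitSum q 2≤q a ≡ k

  -- "a = a_k".
  IsSmallestMultiple : ℕ → Set
  IsSmallestMultiple a = IsCandidate a × (∀ b → IsCandidate b → a ℕ.≤ b)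

fromℕ : ℕ → ℚ
fromℕ n = + n / 1

-- A real number is represented by a Cauchy sequence of rationals.
record ℝ : Set where
  field
    seq    : ℕ → ℚ
    cauchy : ∀ ε → 0ℚ < ε →
             ∃[ N ] (∀ i j → N ℕ.≤ i → N ℕ.≤ j → ∣ seq i - seq j ∣ ≤ ε)

open ℝ public

Positive : ℝ → Set
Positive c = ∃[ δ ] (0ℚ < δ × ∃[ N ] (∀ i → N ℕ.≤ i → δ ≤ seq c i))

-- r ≤ lim u, for a convergent sequence u.
_≤lim_ : ℚ → (ℕ → ℚ) → Set
r ≤lim u = ∀ ε → 0ℚ < ε → ∃[ N ] (∀ i → N ℕ.≤ i → r ≤ u i + ε)

expTerm : ℚ → ℕ → ℚ
expTerm x j = _^_ +-*-rawSemiring x j * (+ 1 / (j !)) {{j !≢0}}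

-- expPartialSum x m = Σ_{j ≤ m} x^j / j!
expPartialSum : ℚ → ℕ → ℚ
expPartialSum x zero    = expTerm x zero
expPartialSum x (suc m) = expPartialSum x m + expTerm x (suc m)

-- If u converges to x then expSeq u converges to exp x, because the
-- exponential series converges uniformly on bounded sets.
expSeq : (ℕ → ℚ) → (ℕ → ℚ)
expSeq u i = expPartialSum (u i) i

-- n ≤exp[ c · k ] says that n ≤ exp (c k), for a real c.
_≤exp[_·_] : ℕ → ℝ → ℕ → Set
n ≤exp[ c · k ] = fromℕ n ≤lim expSeq (λ i → seq c i * fromℕ k)

{-# OPTIONS --safe #-}

-- Any 3k - 2 integers contain k whose sum is divisible by k (a weak form of the
-- Erdős–Ginzburg–Ziv theorem). Applied to the powers 1, q, …, q ^ (3k - 1) this gives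
-- k distinct powers of q whose sum a is divisible by k; its digits are 0 and 1, so its
-- digit sum is k, and a < q ^ (3k).
--
-- For a prime modulus p, either some p of the integers are congruent, or one finds
-- p - 1 disjoint pairs of incongruent ones. Choosing one member of each pair produces
-- sums in all residue classes, as each pair adds at least one class (Cauchy–Davenport
-- for two-element sets). For a composite modulus m n, one splits off disjoint blocks of
-- size m with sums divisible by m, and selects n of these blocks.
module Submission where

open import Defs
open import Data.Digit using (Digit; fromDigits; toDigits)
open import Data.Empty using (⊥-elim)
open import Data.Fin.Base as Fin using (Fin; zero; suc)
import Data.Fin.Properties as Fin
-- The name ℤ.+_ would make every section (x ℤ.+_) ambiguous.
import Data.Integer.Base as ℤ hiding (+_)
open import Data.Integer.Base using (ℤ; +_; 0ℤ)
open import Data.Integer.DivMod using (_%ℕ_; _/ℕ_; n%ℕd<d; a≡a%ℕn+[a/ℕn]*n)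
open import Data.Integer.Divisibility.Signed as ℤ
  using (∣ᵤ⇒∣; ∣⇒∣ᵤ; ∣m∣n⇒∣m+n; ∣m∣n⇒∣m-n; *-monoˡ-∣)
import Data.Integer.Properties as ℤ
import Data.Integer.Tactic.RingSolver as ℤSolver
open import Data.List.Base
  using (List; []; _∷_; _++_; length; map; concatMap; take; drop; foldr; iterate)
open import Data.List.Membership.Propositional using (find)
open import Data.List.Membership.Propositional.Properties using (∈-∃++; ∈-++⁻)
open import Data.List.Properties
  using (length-++; concatMap-++; length-take; length-iterate; take++drop≡id; ++-assoc)
open import Data.List.Relation.Binary.Permutation.Propositional
open import Data.List.Relation.Binary.Permutation.Propositional.Properties
  using (↭-length; ++⁺ˡ; ++⁺ʳ; ++-comm; shift; shifts; drop-∷; ↭-empty-inv; ∈-resp-↭)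
open import Data.List.Relation.Binary.Sublist.Propositional using (_⊆_; []; _∷_; _∷ʳ_)
open import Data.List.Relation.Unary.All using (All; []; _∷_; all?)
open import Data.List.Relation.Unary.All.Properties using (¬All⇒Any¬; take⁺)
open import Data.List.Relation.Unary.Any using (here)
open import Data.Nat.Base
  using (ℕ; zero; suc; pred; _+_; _*_; _∸_; _^_; _%_; _!; _≤_; _<_; z≤n; s≤s; s≤s⁻¹;
         >-nonZero; >-nonZero⁻¹; NonZero; nonTrivial⇒nonZero)
import Data.Nat.Divisibility as ℕ
open import Data.Nat.DivMod using ([m+kn]%n≡m%n; m<n⇒m%n≡m)
open import Data.Nat.Induction using (Acc; acc; <-wellFounded)
open import Data.Nat.ListAction using (sum)
open import Data.Nat.ListAction.Properties using (sum-↭)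
open import Data.Nat.Primality using (Prime; prime?; euclidsLemma; prime⇒nonZero; ¬prime⇒composite)
open import Data.Nat.Properties
import Data.Nat.Tactic.RingSolver as ℕSolver
open import Data.Product.Base as Product using (Σ; _×_; _,_; ∃-syntax; proj₁; proj₂)
open import Data.Rational.Base as ℚ using (ℚ; 0ℚ; 1ℚ; _/_; toℚᵘ; fromℚᵘ)
import Data.Rational.Properties as ℚ
open import Algebra.Definitions.RawSemiring ℚ.+-*-rawSemiring using () renaming (_^_ to _^ℚ_)
open import Data.Rational.Unnormalised.Base as ℚᵘ using (mkℚᵘ; *≡*; *≤*)
import Data.Rational.Unnormalised.Properties as ℚᵘ
open import Data.Sum.Base using (_⊎_; inj₁; inj₂)
open import Function.Base using (_∘_)
open import Relation.Binary.PropositionalEquality as ≡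
  using (_≡_; refl; sym; cong; cong₂; subst; module ≡-Reasoning)
open import Relation.Nullary using (Dec; ¬_; yes; no; contradiction)
open import Relation.Nullary.Decidable using (fromWitness; _×-dec_)
open import Relation.Unary using (Decidable)

-- Inclusion of multisets

infix 4 _≼_

-- The complement `zs` is part of the witness, so that after one selection the next can be made from
-- what is left over.
_≼_ : {A : Set} → List A → List A → Set
ys ≼ xs = ∃[ zs ] (xs ↭ ys ++ zs)

module _ {A : Set} where

  ≼-trans : {xs ys zs : List A} → zs ≼ ys → ys ≼ xs → zs ≼ xs
  ≼-trans {zs = zs} (v , ys↭) (u , xs↭) =
    v ++ u , ↭-trans xs↭ (↭-trans (++⁺ʳ u ys↭) (↭-reflexive (++-assoc zs v u)))

  take-≼ : ∀ n (xs : List A) → take n xs ≼ xs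
  take-≼ n xs = drop n xs , ↭-reflexive (sym (take++drop≡id n xs))

  suffix-≼ : ∀ us (zs : List A) → zs ≼ us ++ zs
  suffix-≼ us zs = us , ++-comm us zs

  ∷-≼ : ∀ {xs ys : List A} x → ys ≼ xs → x ∷ ys ≼ x ∷ xs
  ∷-≼ x (zs , xs↭) = zs , prep x xs↭

  length-≼ : {xs ys : List A} ((zs , _) : ys ≼ xs) → length xs ≡ length ys + length zs
  length-≼ {ys = ys} (zs , xs↭) = ≡.trans (↭-length xs↭) (length-++ ys)

  Σ⟨_⟩ : (A → ℤ) → List A → ℤ
  Σ⟨ f ⟩ = foldr (λ x s → f x ℤ.+ s) 0ℤ

  Σ-++ : ∀ f (xs ys : List A) → Σ⟨ f ⟩ (xs ++ ys) ≡ Σ⟨ f ⟩ xs ℤ.+ Σ⟨ f ⟩ ys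
  Σ-++ f []       ys = sym (ℤ.+-identityˡ _)
  Σ-++ f (x ∷ xs) ys = ≡.trans (cong (λ s → f x ℤ.+ s) (Σ-++ f xs ys)) (sym (ℤ.+-assoc (f x) _ _))

concatMap-≼ : {A B : Set} (g : A → List B) {xs ys : List A} → ys ≼ xs → concatMap g ys ≼ concatMap g xs
concatMap-≼ g {xs} {ys} (zs , xs↭) =
  concatMap g zs , ↭-trans (concatMap-↭ xs↭) (↭-reflexive (concatMap-++ g ys zs))
  where
  concatMap-↭ : ∀ {us vs} → us ↭ vs → concatMap g us ↭ concatMap g vs
  concatMap-↭ refl         = ↭-refl
  concatMap-↭ (prep x p)   = ++⁺ˡ (g x) (concatMap-↭ p)
  concatMap-↭ (swap x y p) =
    ↭-trans (shifts (g x) (g y)) (++⁺ˡ (g y) (++⁺ˡ (g x) (concatMap-↭ p)))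
  concatMap-↭ (trans p q)  = ↭-trans (concatMap-↭ p) (concatMap-↭ q)

-- Zero-sum subfamilies

-- The sharp Erdős–Ginzburg–Ziv bound is k + (k - 1); the weaker bound makes the
-- prime case greedy and is still preserved by products.
ZeroSum : ℕ → Set₁
ZeroSum k = {A : Set} (f : A → ℤ) (xs : List A) → k + 2 * pred k ≤ length xs →
  ∃[ ys ] (ys ≼ xs × length ys ≡ k × + k ℤ.∣ Σ⟨ f ⟩ ys)

-- Residue classes

module Residues (p : ℕ) .{{_ : NonZero p}} where

  residue : ℤ → Fin p
  residue x = Fin.fromℕ< (n%ℕd<d x p)

  residue-≡⇒∣ : ∀ x y → residue x ≡ residue y → + p ℤ.∣ x ℤ.- y
  residue-≡⇒∣ x y eq = ℤ.divides (x /ℕ p ℤ.- y /ℕ p) (begin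
    x ℤ.- y
      ≡⟨ cong₂ ℤ._-_ (a≡a%ℕn+[a/ℕn]*n x p) (a≡a%ℕn+[a/ℕn]*n y p) ⟩
    (+ (x %ℕ p) ℤ.+ (x /ℕ p) ℤ.* + p) ℤ.- (+ (y %ℕ p) ℤ.+ (y /ℕ p) ℤ.* + p)
      ≡⟨ cong (λ r → (+ r ℤ.+ (x /ℕ p) ℤ.* + p) ℤ.- (+ (y %ℕ p) ℤ.+ (y /ℕ p) ℤ.* + p)) %-≡ ⟩
    (+ (y %ℕ p) ℤ.+ (x /ℕ p) ℤ.* + p) ℤ.- (+ (y %ℕ p) ℤ.+ (y /ℕ p) ℤ.* + p)
      ≡⟨ rearrange (+ (y %ℕ p)) (x /ℕ p) (y /ℕ p) (+ p) ⟩
    (x /ℕ p ℤ.- y /ℕ p) ℤ.* + p ∎)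
    where
    open ≡-Reasoning
    rearrange : ∀ r a b c → (r ℤ.+ a ℤ.* c) ℤ.- (r ℤ.+ b ℤ.* c) ≡ (a ℤ.- b) ℤ.* c
    rearrange = ℤSolver.solve-∀
    %-≡ : x %ℕ p ≡ y %ℕ p
    %-≡ = ≡.trans (sym (Fin.toℕ-fromℕ< (n%ℕd<d x p)))
            (≡.trans (cong Fin.toℕ eq) (Fin.toℕ-fromℕ< (n%ℕd<d y p)))

  Incongruent : ∀ {n} → (Fin n → ℤ) → Set
  Incongruent ρ = ∀ i j → + p ℤ.∣ ρ i ℤ.- ρ j → i ≡ j

  -- Pigeonhole on the `p` values together with an extra `0`: two of these `p + 1` integers are
  -- congruent, and since the values of `ρ` are pairwise incongruent, one of the two is the added
  -- `0`.
  complete-residues : (ρ : Fin p → ℤ) → Incongruent ρ → ∃[ i ] (+ p ℤ.∣ ρ i)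
  complete-residues ρ ρ-inj with Fin.any? (λ i → + p ℤ.∣? ρ i)
  ... | yes hit = hit
  ... | no miss = ⊥-elim (clash (Fin.pigeonhole ≤-refl (residue ∘ ρ₀)))
    where
    ρ₀ : Fin (suc p) → ℤ
    ρ₀ zero    = 0ℤ
    ρ₀ (suc i) = ρ i
    clash : ¬ (∃[ i ] ∃[ j ] (i Fin.< j × residue (ρ₀ i) ≡ residue (ρ₀ j)))
    clash (zero , suc j , _ , eq) =
      miss (j , subst (+ p ℤ.∣_) (ℤ.+-identityʳ (ρ j)) (residue-≡⇒∣ (ρ j) 0ℤ (sym eq)))
    clash (suc i , suc j , s≤s i<j , eq) =
      Fin.<⇒≢ i<j (ρ-inj i j (residue-≡⇒∣ (ρ i) (ρ j) eq))

-- Prime moduli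

module PrimeCase (p : ℕ) (p-prime : Prime p) where

  private instance
    p≢0 : NonZero p
    p≢0 = prime⇒nonZero p-prime

  open Residues p

  -- Following x ↦ x + d inside the family must revisit an index after t ≤ n + 1 < p
  -- steps, which forces p ∣ t d.
  not-shift-closed : ∀ {n} (ρ : Fin (suc n) → ℤ) d → suc n < p → ¬ (+ p ℤ.∣ d) →
    ¬ (∀ i → ∃[ j ] (+ p ℤ.∣ (ρ i ℤ.+ d) ℤ.- ρ j))
  not-shift-closed {n} ρ d n<p p∤d next = clash (Fin.pigeonhole ≤-refl (orbit ∘ Fin.toℕ))
    where
    orbit : ℕ → Fin (suc n)
    orbit zero    = zero
    orbit (suc t) = proj₁ (next (orbit t))

    orbit-ρ : ∀ t → + p ℤ.∣ (ρ zero ℤ.+ + t ℤ.* d) ℤ.- ρ (orbit t)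
    orbit-ρ zero    = ℤ.divides 0ℤ (start (ρ zero) d)
      where
      start : ∀ x d → (x ℤ.+ 0ℤ ℤ.* d) ℤ.- x ≡ 0ℤ
      start = ℤSolver.solve-∀
    orbit-ρ (suc t) = subst (+ p ℤ.∣_) (step (ρ zero) (+ t) d (ρ (orbit t)) (ρ (orbit (suc t))))
      (∣m∣n⇒∣m+n (orbit-ρ t) (proj₂ (next (orbit t))))
      where
      step : ∀ x t d y z → ((x ℤ.+ t ℤ.* d) ℤ.- y) ℤ.+ ((y ℤ.+ d) ℤ.- z)
        ≡ (x ℤ.+ (+ 1 ℤ.+ t) ℤ.* d) ℤ.- z
      step = ℤSolver.solve-∀

    clash : ¬ (∃[ i ] ∃[ j ] (i Fin.< j × orbit (Fin.toℕ i) ≡ orbit (Fin.toℕ j)))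
    clash (i , j , i<j , eq) with euclidsLemma ℤ.∣ + t ℤ.- + s ∣ ℤ.∣ d ∣ p-prime p∣abs
      where
      s = Fin.toℕ i
      t = Fin.toℕ j
      difference : ∀ x t s d y →
        ((x ℤ.+ t ℤ.* d) ℤ.- y) ℤ.- ((x ℤ.+ s ℤ.* d) ℤ.- y) ≡ (t ℤ.- s) ℤ.* d
      difference = ℤSolver.solve-∀
      p∣[t-s]d : + p ℤ.∣ (+ t ℤ.- + s) ℤ.* d
      p∣[t-s]d = subst (+ p ℤ.∣_) (difference (ρ zero) (+ t) (+ s) d (ρ (orbit t)))
        (∣m∣n⇒∣m-n (orbit-ρ t)
          (subst (λ u → + p ℤ.∣ (ρ zero ℤ.+ + s ℤ.* d) ℤ.- ρ u) eq (orbit-ρ s)))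
      p∣abs : p ℕ.∣ ℤ.∣ + t ℤ.- + s ∣ * ℤ.∣ d ∣
      p∣abs = subst (p ℕ.∣_) (ℤ.abs-* (+ t ℤ.- + s) d) (∣⇒∣ᵤ p∣[t-s]d)
    ... | inj₂ p∣d = p∤d (∣ᵤ⇒∣ p∣d)
    -- The indices satisfy `0 < t - s < p`, so the other factor is not divisible by `p` either.
    ... | inj₁ p∣t-s = ℕ.>⇒∤ {{>-nonZero (m<n⇒0<n∸m i<j)}} t∸s<p
                         (subst (p ℕ.∣_) abs-≡ p∣t-s)
      where
      s = Fin.toℕ i
      t = Fin.toℕ j
      abs-≡ : ℤ.∣ + t ℤ.- + s ∣ ≡ t ∸ s
      abs-≡ = ≡.trans (cong ℤ.∣_∣ (ℤ.m-n≡m⊖n t s))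
        (≡.trans (ℤ.∣m⊖n∣≡∣n⊖m∣ t s) (ℤ.∣⊖∣-≤ (<⇒≤ i<j)))
      t∸s<p : t ∸ s < p
      t∸s<p = ≤-<-trans (m∸n≤m t s) (≤-<-trans (Fin.toℕ≤pred[n] j) n<p)

  module _ {A : Set} (f : A → ℤ) where

    ZeroSumIn : List A → Set
    ZeroSumIn xs = ∃[ ys ] (ys ≼ xs × length ys ≡ p × + p ℤ.∣ Σ⟨ f ⟩ ys)

    -- Since all members have size `suc j`, at `j = p - 1` these are `p` incongruent sums of `p`
    -- elements each, and one of them must be divisible by `p`.
    Family : ℕ → List A → Set
    Family j xs = Σ (Fin (suc j) → List A) λ c →
      (∀ i → c i ≼ xs) × (∀ i → length (c i) ≡ suc j) × Incongruent (Σ⟨ f ⟩ ∘ c)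

    ZeroSumIn-≼ : ∀ {xs ys} → ys ≼ xs → ZeroSumIn ys → ZeroSumIn xs
    ZeroSumIn-≼ ys≼xs (zs , zs≼ys , rest) = zs , ≼-trans zs≼ys ys≼xs , rest

    Σ-constant : ∀ c (ys : List A) → All (λ y → + p ℤ.∣ f y ℤ.- c) ys →
      + p ℤ.∣ Σ⟨ f ⟩ ys ℤ.- + length ys ℤ.* c
    Σ-constant c []       []         = ℤ.divides 0ℤ refl
    Σ-constant c (y ∷ ys) (py ∷ pys) = subst (+ p ℤ.∣_)
      (step (f y) c (Σ⟨ f ⟩ ys) (+ length ys)) (∣m∣n⇒∣m+n py (Σ-constant c ys pys))
      where
      step : ∀ y c s l → (y ℤ.- c) ℤ.+ (s ℤ.- l ℤ.* c) ≡ (y ℤ.+ s) ℤ.- (+ 1 ℤ.+ l) ℤ.* c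
      step = ℤSolver.solve-∀

    -- Any `p` elements congruent to `c` have a sum congruent to `p * c`, hence to zero.
    constant⇒zeroSum : ∀ c xs → p ≤ length xs → All (λ y → + p ℤ.∣ f y ℤ.- c) xs → ZeroSumIn xs
    constant⇒zeroSum c xs p≤ const = take p xs , take-≼ p xs , len ,
      subst (+ p ℤ.∣_) (cancel (Σ⟨ f ⟩ (take p xs)) (+ p) c) (∣m∣n⇒∣m+n
        (subst (λ l → + p ℤ.∣ Σ⟨ f ⟩ (take p xs) ℤ.- + l ℤ.* c) len
          (Σ-constant c (take p xs) (take⁺ p const)))
        (ℤ.divides c (ℤ.*-comm (+ p) c)))
      where
      len : length (take p xs) ≡ p
      len = ≡.trans (length-take p xs) (m≤n⇒m⊓n≡m p≤)
      cancel : ∀ s l c → (s ℤ.- l ℤ.* c) ℤ.+ l ℤ.* c ≡ s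
      cancel = ℤSolver.solve-∀

    -- Every element is compared with the head; the first incongruent one found forms the pair with
    -- it.
    constant-or-pair : ∀ xs → p ≤ length xs → ZeroSumIn xs ⊎
      (∃[ a ] ∃[ b ] ∃[ zs ] (xs ↭ a ∷ b ∷ zs × ¬ (+ p ℤ.∣ f b ℤ.- f a)))
    constant-or-pair []       p≤0 = inj₁ (constant⇒zeroSum 0ℤ [] p≤0 [])
    constant-or-pair (x ∷ xs) p≤  with all? (λ y → + p ℤ.∣? f y ℤ.- f x) xs
    ... | yes const = inj₁ (constant⇒zeroSum (f x) (x ∷ xs) p≤
            (ℤ.divides 0ℤ (ℤ.+-inverseʳ (f x)) ∷ const))
    ... | no ¬const with find (¬All⇒Any¬ (λ y → + p ℤ.∣? f y ℤ.- f x) xs ¬const)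
    ... | y , y∈xs , y≢x with ∈-∃++ y∈xs
    ... | us , vs , refl = inj₂ (x , y , us ++ vs , prep x (shift y us vs) , y≢x)

    -- Adding `a` to every member keeps the sums incongruent. As there are fewer than `p` of them,
    -- they are not closed under the shift by `f b - f a`, so for some member `c i₀` adding `b`
    -- instead of `a` gives a further residue class.
    extend : ∀ {j} {xs zs : List A} {a b} → suc j < p → xs ↭ a ∷ b ∷ zs →
      ¬ (+ p ℤ.∣ f b ℤ.- f a) → Family j zs → Family (suc j) xs
    extend {j} {xs} {zs} {a} {b} j<p xs↭ b≢a (c , c≼ , c-len , c-inj)
      with Fin.all? (λ i → Fin.any? (λ i′ → + p ℤ.∣?
             (Σ⟨ f ⟩ (c i) ℤ.+ (f b ℤ.- f a)) ℤ.- Σ⟨ f ⟩ (c i′)))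
    ... | yes closed = ⊥-elim (not-shift-closed (Σ⟨ f ⟩ ∘ c) (f b ℤ.- f a) j<p b≢a closed)
    ... | no ¬closed with Fin.¬∀⟶∃¬ _ _ (λ i → Fin.any? (λ i′ → + p ℤ.∣?
                            (Σ⟨ f ⟩ (c i) ℤ.+ (f b ℤ.- f a)) ℤ.- Σ⟨ f ⟩ (c i′))) ¬closed
    ... | i₀ , escapes = c′ , c′≼ , c′-len , c′-inj
      where
      c′ : Fin (suc (suc j)) → List A
      c′ zero    = b ∷ c i₀
      c′ (suc i) = a ∷ c i

      ↭⇒≼ : ∀ {ys} → ys ≼ a ∷ b ∷ zs → ys ≼ xs
      ↭⇒≼ (us , ↭us) = us , ↭-trans xs↭ ↭us

      c′≼ : ∀ i → c′ i ≼ xs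
      c′≼ zero    = ↭⇒≼ (≼-trans (∷-≼ b (c≼ i₀)) (suffix-≼ (a ∷ []) (b ∷ zs)))
      c′≼ (suc i) = ↭⇒≼ (∷-≼ a (≼-trans (c≼ i) (suffix-≼ (b ∷ []) zs)))

      c′-len : ∀ i → length (c′ i) ≡ suc (suc j)
      c′-len zero    = cong suc (c-len i₀)
      c′-len (suc i) = cong suc (c-len i)

      new-old : ∀ b s a s′ → (b ℤ.+ s) ℤ.- (a ℤ.+ s′) ≡ (s ℤ.+ (b ℤ.- a)) ℤ.- s′
      new-old = ℤSolver.solve-∀
      old-old : ∀ a s s′ → (a ℤ.+ s) ℤ.- (a ℤ.+ s′) ≡ s ℤ.- s′
      old-old = ℤSolver.solve-∀
      old-new : ∀ b s a s′ → ℤ.- ((a ℤ.+ s′) ℤ.- (b ℤ.+ s)) ≡ (s ℤ.+ (b ℤ.- a)) ℤ.- s′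
      old-new = ℤSolver.solve-∀

      c′-inj : Incongruent (Σ⟨ f ⟩ ∘ c′)
      c′-inj zero    zero    _   = refl
      c′-inj zero    (suc i) p∣ = ⊥-elim (escapes (i ,
        subst (+ p ℤ.∣_) (new-old (f b) (Σ⟨ f ⟩ (c i₀)) (f a) (Σ⟨ f ⟩ (c i))) p∣))
      c′-inj (suc i) zero    p∣ = ⊥-elim (escapes (i ,
        subst (+ p ℤ.∣_) (old-new (f b) (Σ⟨ f ⟩ (c i₀)) (f a) (Σ⟨ f ⟩ (c i))) (ℤ.∣m⇒∣-m p∣)))
      c′-inj (suc i) (suc k) p∣ = cong suc (c-inj i k
        (subst (+ p ℤ.∣_) (old-old (f a) (Σ⟨ f ⟩ (c i)) (Σ⟨ f ⟩ (c k))) p∣))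

    -- Each pair costs two elements, so at least `p` remain whenever the next pair is sought. Once
    -- all pairs are removed, a single remaining element starts the family.
    zeroSum-or-family : ∀ j xs → j < p → p + 2 * j ≤ length xs → ZeroSumIn xs ⊎ Family j xs
    zeroSum-or-family zero [] _ p≤ = ⊥-elim (<⇒≱ (>-nonZero⁻¹ p) (≤-trans (m≤m+n p 0) p≤))
    zeroSum-or-family zero (x ∷ xs) _ _ =
      inj₂ ((λ _ → x ∷ []) , (λ _ → xs , refl) , (λ _ → refl) , λ { zero zero _ → refl })
    zeroSum-or-family (suc j) xs j<p len≤
      with constant-or-pair xs (≤-trans (m≤m+n p _) len≤)
    ... | inj₁ found = inj₁ found
    ... | inj₂ (a , b , zs , xs↭ , b≢a)
      with zeroSum-or-family j zs (<-trans (n<1+n j) j<p) len′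
      where
      shifted : ∀ p j → p + 2 * suc j ≡ suc (suc (p + 2 * j))
      shifted = ℕSolver.solve-∀
      len′ : p + 2 * j ≤ length zs
      len′ = s≤s⁻¹ (s≤s⁻¹
        (≤-trans (≤-reflexive (sym (shifted p j))) (≤-trans len≤ (≤-reflexive (↭-length xs↭)))))
    ... | inj₁ found = inj₁ (ZeroSumIn-≼
      (a ∷ b ∷ [] , ↭-trans xs↭ (++-comm (a ∷ b ∷ []) zs)) found)
    ... | inj₂ fam = inj₂ (extend j<p xs↭ b≢a fam)

  prime-zeroSum : ZeroSum p
  prime-zeroSum f xs len≤ with zeroSum-or-family f (pred p) xs (pred[n]<n p) len≤
    where
    pred[n]<n : ∀ n .{{_ : NonZero n}} → pred n < n
    pred[n]<n (suc n) = ≤-refl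
  ... | inj₁ found = found
  ... | inj₂ (c , c≼ , c-len , c-inj) = choose p refl c c≼ c-len c-inj
    where
    -- Generalising `p` to `p′` lets the match on `suc p′` identify `suc (pred p′)` with the
    -- modulus.
    choose : ∀ p′ → p ≡ p′ → (c : Fin (suc (pred p′)) → List _) → (∀ i → c i ≼ xs) →
      (∀ i → length (c i) ≡ suc (pred p′)) → Incongruent (Σ⟨ f ⟩ ∘ c) → ZeroSumIn f xs
    choose (suc p′) refl c c≼ c-len c-inj with complete-residues (Σ⟨ f ⟩ ∘ c) c-inj
    ... | i , p∣ = c i , c≼ i , c-len i , p∣

-- Composite moduli

module Blocks (m n : ℕ) (m-zeroSum : ZeroSum (suc m)) (n-zeroSum : ZeroSum (suc n))
               {A : Set} (f : A → ℤ) where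

  Block : Set
  Block = ∃[ ys ] (length ys ≡ suc m × + suc m ℤ.∣ Σ⟨ f ⟩ ys)

  elements : Block → List A
  elements = proj₁

  -- The weight of a block when blocks are themselves treated as elements, in the application of
  -- `n-zeroSum`.
  quotientSum : Block → ℤ
  quotientSum (_ , _ , m∣) = ℤ.quotient m∣

  length-elements : ∀ bs → length (concatMap elements bs) ≡ length bs * suc m
  length-elements []                   = refl
  length-elements ((ys , len , _) ∷ bs) =
    ≡.trans (length-++ ys) (cong₂ _+_ len (length-elements bs))

  Σ-elements : ∀ bs → Σ⟨ f ⟩ (concatMap elements bs) ≡ Σ⟨ quotientSum ⟩ bs ℤ.* + suc m
  Σ-elements []                                     = refl
  Σ-elements ((ys , _ , ℤ.divides q Σ≡q*m) ∷ bs) =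
    ≡.trans (Σ-++ f ys (concatMap elements bs))
      (≡.trans (cong₂ ℤ._+_ Σ≡q*m (Σ-elements bs))
        (sym (ℤ.*-distribʳ-+ (+ suc m) q (Σ⟨ quotientSum ⟩ bs))))

  -- Each block uses up `suc m` elements. The reserve of `2 * m` is never spent, so `m-zeroSum`
  -- still applies when the last block is split off.
  disjoint-blocks : ∀ N xs → N * suc m + 2 * m ≤ length xs →
    ∃[ bs ] (length bs ≡ N × concatMap elements bs ≼ xs)
  disjoint-blocks zero    xs _    = [] , refl , xs , refl
  disjoint-blocks (suc N) xs len≤
    with m-zeroSum f xs (≤-trans (+-monoˡ-≤ (2 * m) (m≤m+n (suc m) (N * suc m))) len≤)
  ... | ys , (zs , xs↭) , ys-len , m∣Σ
    with disjoint-blocks N zs (+-cancelˡ-≤ (suc m) _ _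
           (≤-trans (≤-reflexive (sym (+-assoc (suc m) (N * suc m) (2 * m))))
             (≤-trans len≤ (≤-reflexive
               (≡.trans (length-≼ {ys = ys} (zs , xs↭)) (cong (_+ length zs) ys-len))))))
  ... | bs , bs-len , us , zs↭ = (ys , ys-len , m∣Σ) ∷ bs , cong suc bs-len , us ,
    ↭-trans xs↭ (↭-trans (++⁺ˡ ys zs↭) (↭-reflexive (sym (++-assoc ys (concatMap elements bs) us))))

  -- Among `suc n + 2 * n` blocks, `suc n` have quotients summing to a multiple of `suc n`;
  -- multiplying back by `suc m` gives divisibility by the product.
  block-zeroSum : ∀ xs → (suc n + 2 * n) * suc m + 2 * m ≤ length xs →
    ∃[ ys ] (ys ≼ xs × length ys ≡ suc n * suc m × + suc n ℤ.* + suc m ℤ.∣ Σ⟨ f ⟩ ys)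
  block-zeroSum xs len≤ with disjoint-blocks (suc n + 2 * n) xs len≤
  ... | bs , bs-len , bs≼xs with n-zeroSum quotientSum bs (≤-reflexive (sym bs-len))
  ... | cs , cs≼bs , cs-len , n∣Σ = concatMap elements cs ,
      ≼-trans (concatMap-≼ elements cs≼bs) bs≼xs ,
      ≡.trans (length-elements cs) (cong (_* suc m) cs-len) ,
      subst (λ s → + suc n ℤ.* + suc m ℤ.∣ s) (sym (Σ-elements cs)) (*-monoˡ-∣ (+ suc m) n∣Σ)

zeroSum-* : ∀ m n .{{_ : NonZero m}} .{{_ : NonZero n}} → ZeroSum m → ZeroSum n → ZeroSum (n * m)
zeroSum-* (suc m) (suc n) m-zeroSum n-zeroSum f xs len≤ =
  Product.map₂ (λ {ys} → Product.map₂ (Product.map₂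
      (subst (λ d → d ℤ.∣ Σ⟨ f ⟩ ys) (sym (ℤ.pos-* (suc n) (suc m))))))
    (Blocks.block-zeroSum m n m-zeroSum n-zeroSum f xs (≤-trans (≤-reflexive (count m n)) len≤))
  where
  -- The predecessor of `suc n * suc m` is `m + n * suc m`, so the blocks and the reserve together
  -- require exactly the bound for the product.
  count : ∀ m n → (suc n + 2 * n) * suc m + 2 * m ≡ suc n * suc m + 2 * (m + n * suc m)
  count = ℕSolver.solve-∀

-- Strong induction: a composite modulus is a proper divisor times a proper quotient, and primes and
-- `1` are the base cases.
zeroSum : ∀ k .{{_ : NonZero k}} → ZeroSum k
zeroSum k = go k (<-wellFounded k)
  where
  go : ∀ k .{{_ : NonZero k}} → Acc _<_ k → ZeroSum k
  go 1 _ f (x ∷ xs) _ =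
    x ∷ [] , (xs , refl) , refl , ℤ.divides (f x ℤ.+ 0ℤ) (sym (ℤ.*-identityʳ _))
  go k@(suc (suc _)) (acc rec) with prime? k
  ... | yes k-prime = PrimeCase.prime-zeroSum k k-prime
  ... | no ¬k-prime with ¬prime⇒composite ¬k-prime
  ... | record { divisor = d ; divisor-< = d<k ; divisor-∣ = d∣k } =
    subst ZeroSum (sym (ℕ.m∣n⇒n≡quotient*m d∣k))
      (zeroSum-* d (ℕ.quotient d∣k) {{nonTrivial⇒nonZero d}} {{ℕ.quotient≢0 d∣k}}
        (go d {{nonTrivial⇒nonZero d}} (rec d<k))
        (go (ℕ.quotient d∣k) {{ℕ.quotient≢0 d∣k}} (rec (ℕ.quotient-< d∣k))))

-- From sub-multisets to sublists

-- Restoring the order of `xs` tells for each position whether it was selected; for the list of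
-- powers of `q` these decisions are the digits.
≼⇒⊆ : {A : Set} {xs ys : List A} → ys ≼ xs → ∃[ ys′ ] (ys′ ⊆ xs × ys′ ↭ ys)
≼⇒⊆ {xs = []} {[]}    _          = [] , [] , refl
≼⇒⊆ {xs = []} {_ ∷ _} (zs , xs↭) = contradiction (↭-empty-inv (↭-sym xs↭)) λ ()
≼⇒⊆ {xs = x ∷ xs} {ys} (zs , xs↭) with ∈-++⁻ ys (∈-resp-↭ xs↭ (here refl))
... | inj₁ x∈ys with ∈-∃++ x∈ys
... | us , vs , refl =
  let ys′ , ys′⊆xs , ys′↭ = ≼⇒⊆ (zs , drop-∷ (↭-trans xs↭ (++⁺ʳ zs (shift x us vs))))
  in x ∷ ys′ , refl ∷ ys′⊆xs , ↭-trans (prep x ys′↭) (↭-sym (shift x us vs))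
≼⇒⊆ {xs = x ∷ xs} {ys} (zs , xs↭) | inj₂ x∈zs with ∈-∃++ x∈zs
... | us , vs , refl =
  let ys′ , ys′⊆xs , ys′↭ = ≼⇒⊆ (us ++ vs , drop-∷ (↭-trans xs↭ (↭-trans
        (↭-trans (↭-reflexive (sym (++-assoc ys us (x ∷ vs)))) (shift x (ys ++ us) vs))
        (prep x (↭-reflexive (++-assoc ys us vs))))))
  in ys′ , x ∷ʳ ys′⊆xs , ys′↭

-- Digit sums in base q

module Base (q : ℕ) (2≤q : 2 ≤ q) where

  private instance
    q≢0 : NonZero q
    q≢0 = >-nonZero (<-trans (s≤s z≤n) 2≤q)

  sumDigits : List (Digit q) → ℕ
  sumDigits ds = sum (map Fin.toℕ ds)

  -- Reduction modulo `q` recovers the digit, which can then be cancelled.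
  digit-unique : ∀ (d e : Digit q) m n → Fin.toℕ d + m * q ≡ Fin.toℕ e + n * q → d ≡ e × m ≡ n
  digit-unique d e m n eq = d≡e , *-cancelʳ-≡ m n q (+-cancelˡ-≡ (Fin.toℕ d) _ _
      (≡.trans eq (cong (λ r → Fin.toℕ r + n * q) (sym d≡e))))
    where
    remainder : ∀ (d : Digit q) m → (Fin.toℕ d + m * q) % q ≡ Fin.toℕ d
    remainder d m = ≡.trans ([m+kn]%n≡m%n (Fin.toℕ d) m q) (m<n⇒m%n≡m (Fin.toℕ<n d))
    d≡e : d ≡ e
    d≡e = Fin.toℕ-injective (≡.trans (sym (remainder d m))
      (≡.trans (cong (_% q) eq) (remainder e n)))

  fromDigits≡0⇒sumDigits≡0 : ∀ (ds : List (Digit q)) → fromDigits ds ≡ 0 → sumDigits ds ≡ 0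
  fromDigits≡0⇒sumDigits≡0 []       _  = refl
  fromDigits≡0⇒sumDigits≡0 (d ∷ ds) eq = cong₂ _+_ (m+n≡0⇒m≡0 _ eq)
    (fromDigits≡0⇒sumDigits≡0 ds (m*n≡0⇒m≡0 _ q (m+n≡0⇒n≡0 (Fin.toℕ d) eq)))

  -- Expansions of the same number may differ by leading zeros.
  sumDigits-unique : ∀ (ds es : List (Digit q)) → fromDigits ds ≡ fromDigits es →
    sumDigits ds ≡ sumDigits es
  sumDigits-unique []       es       eq = sym (fromDigits≡0⇒sumDigits≡0 es (sym eq))
  sumDigits-unique (d ∷ ds) []       eq = fromDigits≡0⇒sumDigits≡0 (d ∷ ds) eq
  sumDigits-unique (d ∷ ds) (e ∷ es) eq with digit-unique d e (fromDigits ds) (fromDigits es) eq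
  ... | refl , eq′ = cong (λ s → Fin.toℕ d + s) (sumDigits-unique ds es eq′)

  digitSum-fromDigits : ∀ (ds : List (Digit q)) → digitSum q 2≤q (fromDigits ds) ≡ sumDigits ds
  digitSum-fromDigits ds with toDigits q {fromWitness 2≤q} (fromDigits ds)
  ... | es , eq = sumDigits-unique es ds eq

  0d 1d : Digit q
  0d = Fin.fromℕ< {0} (<-trans (s≤s z≤n) 2≤q)
  1d = Fin.fromℕ< {1} 2≤q

  -- A skipped power contributes the digit `0`, a kept one the digit `1`. The starting weight `w` is
  -- arbitrary because the tail of the list starts at `w * q`.
  subset-expansion : ∀ w L {ys} → ys ⊆ iterate (_* q) w L →
    ∃[ ds ] (sum ys ≡ w * fromDigits ds × sumDigits ds ≡ length ys)
  subset-expansion w zero    []  = [] , sym (*-zeroʳ w) , refl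
  subset-expansion w (suc L) (.w ∷ʳ ys⊆) with subset-expansion (w * q) L ys⊆
  ... | ds , sum-≡ , len-≡ = 0d ∷ ds ,
    ≡.trans sum-≡ (≡.trans (shift-≡ w q (fromDigits ds))
      (cong (λ z → w * (z + fromDigits ds * q)) (sym 0d≡0))) ,
    ≡.trans (cong (_+ sumDigits ds) 0d≡0) len-≡
    where
    0d≡0 : Fin.toℕ 0d ≡ 0
    0d≡0 = Fin.toℕ-fromℕ< _
    shift-≡ : ∀ w q x → w * q * x ≡ w * (0 + x * q)
    shift-≡ = ℕSolver.solve-∀
  subset-expansion w (suc L) (refl ∷ ys⊆) with subset-expansion (w * q) L ys⊆
  ... | ds , sum-≡ , len-≡ = 1d ∷ ds ,
    ≡.trans (cong (λ s → w + s) sum-≡) (≡.trans (shift-≡ w q (fromDigits ds))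
      (cong (λ z → w * (z + fromDigits ds * q)) (sym 1d≡1))) ,
    cong₂ _+_ 1d≡1 len-≡
    where
    1d≡1 : Fin.toℕ 1d ≡ 1
    1d≡1 = Fin.toℕ-fromℕ< _
    shift-≡ : ∀ w q x → w + w * q * x ≡ w * (1 + x * q)
    shift-≡ = ℕSolver.solve-∀

  digitSum-subset : ∀ L {ys} → ys ⊆ iterate (_* q) 1 L → digitSum q 2≤q (sum ys) ≡ length ys
  digitSum-subset L ys⊆ with subset-expansion 1 L ys⊆
  ... | ds , sum-≡ , len-≡ = ≡.trans
    (cong (digitSum q 2≤q) (≡.trans sum-≡ (*-identityˡ (fromDigits ds))))
    (≡.trans (digitSum-fromDigits ds) len-≡)

  -- The additional `w` on the left carries the induction: a kept entry turns it into `w + w`, which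
  -- is at most `w * q`, the starting weight of the tail.
  subset-sum-bound : ∀ w L {ys} → ys ⊆ iterate (_* q) w L → w + sum ys ≤ w * q ^ L
  subset-sum-bound w zero    [] = ≤-reflexive (≡.trans (+-identityʳ w) (sym (*-identityʳ w)))
  subset-sum-bound w (suc L) {ys} (.w ∷ʳ ys⊆) = begin
    w + sum ys         ≤⟨ +-monoˡ-≤ (sum ys) (m≤m*n w q) ⟩
    w * q + sum ys     ≤⟨ subset-sum-bound (w * q) L ys⊆ ⟩
    w * q * q ^ L      ≡⟨ *-assoc w q (q ^ L) ⟩
    w * (q * q ^ L)    ∎
    where open ≤-Reasoning
  subset-sum-bound w (suc L) {.w ∷ ys} (refl ∷ ys⊆) = begin
    w + (w + sum ys)   ≡⟨ double w (sum ys) ⟩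
    w * 2 + sum ys     ≤⟨ +-monoˡ-≤ (sum ys) (*-monoʳ-≤ w 2≤q) ⟩
    w * q + sum ys     ≤⟨ subset-sum-bound (w * q) L ys⊆ ⟩
    w * q * q ^ L      ≡⟨ *-assoc w q (q ^ L) ⟩
    w * (q * q ^ L)    ∎
    where
    open ≤-Reasoning
    double : ∀ w s → w + (w + s) ≡ w * 2 + s
    double = ℕSolver.solve-∀

-- Linear search upwards from zero. The bound `m ≤ a` passes the estimate for a known witness on to
-- the smallest one.
least : ∀ {P : ℕ → Set} → Decidable P → ∀ a → P a →
  ∃[ m ] ((P m × (∀ b → P b → m ≤ b)) × m ≤ a)
least P? zero    Pa = zero , (Pa , λ _ _ → z≤n) , z≤n
least {P} P? (suc a) Pa with P? zero
... | yes P0 = zero , (P0 , λ _ _ → z≤n) , z≤n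
... | no ¬P0 with least (P? ∘ suc) a Pa
... | m , (Pm , m-min) , m≤a = suc m , (Pm , min′) , s≤s m≤a
  where
  min′ : ∀ b → P b → suc m ≤ b
  min′ zero    P0 = contradiction P0 ¬P0
  min′ (suc b) Pb = s≤s (m-min b Pb)

-- Lower bounds for the exponential series

p≤p+q : ∀ p {q} → 0ℚ ℚ.≤ q → p ℚ.≤ p ℚ.+ q
p≤p+q p 0≤q = ℚ.≤-trans (ℚ.≤-reflexive (sym (ℚ.+-identityʳ p))) (ℚ.+-monoʳ-≤ p 0≤q)

p≤q+p : ∀ {q} p → 0ℚ ℚ.≤ q → p ℚ.≤ q ℚ.+ p
p≤q+p p 0≤q = ℚ.≤-trans (ℚ.≤-reflexive (sym (ℚ.+-identityˡ p))) (ℚ.+-monoˡ-≤ p 0≤q)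

fromℚᵘ-homo-* : ∀ p q → fromℚᵘ (p ℚᵘ.* q) ≡ fromℚᵘ p ℚ.* fromℚᵘ q
fromℚᵘ-homo-* p q = ℚ.toℚᵘ-injective (begin
  toℚᵘ (fromℚᵘ (p ℚᵘ.* q))                ≈⟨ ℚ.toℚᵘ-fromℚᵘ (p ℚᵘ.* q) ⟩
  p ℚᵘ.* q                                ≈⟨ ℚᵘ.*-cong (ℚ.toℚᵘ-fromℚᵘ p) (ℚ.toℚᵘ-fromℚᵘ q) ⟨
  toℚᵘ (fromℚᵘ p) ℚᵘ.* toℚᵘ (fromℚᵘ q)    ≈⟨ ℚ.toℚᵘ-homo-* (fromℚᵘ p) (fromℚᵘ q) ⟨
  toℚᵘ (fromℚᵘ p ℚ.* fromℚᵘ q)            ∎)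
  where open ℚᵘ.≃-Reasoning

fromℚᵘ-mono-≤ : ∀ {p q} → p ℚᵘ.≤ q → fromℚᵘ p ℚ.≤ fromℚᵘ q
fromℚᵘ-mono-≤ {p} {q} p≤q = ℚ.toℚᵘ-cancel-≤ (begin
  toℚᵘ (fromℚᵘ p) ≃⟨ ℚ.toℚᵘ-fromℚᵘ p ⟩
  p               ≤⟨ p≤q ⟩
  q               ≃⟨ ℚ.toℚᵘ-fromℚᵘ q ⟨
  toℚᵘ (fromℚᵘ q) ∎)
  where open ℚᵘ.≤-Reasoning

fromℕ-homo-* : ∀ m n → fromℕ (m * n) ≡ fromℕ m ℚ.* fromℕ n
fromℕ-homo-* m n = ≡.trans (cong (_/ 1) (ℤ.pos-* m n)) (fromℚᵘ-homo-* (mkℚᵘ (+ m) 0) (mkℚᵘ (+ n) 0))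

fromℕ-homo-^ : ∀ m n → fromℕ (m ^ n) ≡ fromℕ m ^ℚ n
fromℕ-homo-^ m zero    = refl
fromℕ-homo-^ m (suc n) = ≡.trans (fromℕ-homo-* m (m ^ n)) (cong (fromℕ m ℚ.*_) (fromℕ-homo-^ m n))

fromℕ-mono-≤ : ∀ {m n} → m ≤ n → fromℕ m ℚ.≤ fromℕ n
fromℕ-mono-≤ {m} {n} m≤n = fromℚᵘ-mono-≤ {mkℚᵘ (+ m) 0} {mkℚᵘ (+ n) 0}
  (*≤* (ℤ.*-monoʳ-≤-nonNeg (+ 1) (ℤ.+≤+ m≤n)))

fromℕ-inverse : ∀ d .{{_ : NonZero d}} → fromℕ d ℚ.* (+ 1 / d) ≡ 1ℚ
fromℕ-inverse (suc d) = ≡.trans (sym (fromℚᵘ-homo-* (mkℚᵘ (+ suc d) 0) (mkℚᵘ (+ 1) d)))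
  (ℚ.fromℚᵘ-cong {mkℚᵘ (+ suc d) 0 ℚᵘ.* mkℚᵘ (+ 1) d} {mkℚᵘ (+ 1) 0}
    (*≡* (cong +_ (numerator d))))
  where
  numerator : ∀ d → suc d * 1 * 1 ≡ 1 * (1 * suc d)
  numerator = ℕSolver.solve-∀

expTerm-nonNeg : ∀ y j → ℚ.NonNegative (expTerm (fromℕ y) j)
expTerm-nonNeg y j = subst (λ x → ℚ.NonNegative (x ℚ.* _)) (fromℕ-homo-^ y j)
  (ℚ.nonNeg*nonNeg⇒nonNeg (fromℕ (y ^ j)) {{ℚ.normalize-nonNeg (y ^ j) 1}}
    ((+ 1 / (j !)) {{j !≢0}}) {{ℚ.normalize-nonNeg 1 (j !) {{j !≢0}}}})

expTerm-lower-bound : ∀ y j n → n * j ! ≤ y ^ j → fromℕ n ℚ.≤ expTerm (fromℕ y) j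
expTerm-lower-bound y j n n*j!≤ = begin
  fromℕ n                               ≡⟨ ℚ.*-identityʳ (fromℕ n) ⟨
  fromℕ n ℚ.* 1ℚ                        ≡⟨ cong (fromℕ n ℚ.*_) (fromℕ-inverse (j !)) ⟨
  fromℕ n ℚ.* (fromℕ (j !) ℚ.* 1/j!)    ≡⟨ ℚ.*-assoc (fromℕ n) (fromℕ (j !)) 1/j! ⟨
  fromℕ n ℚ.* fromℕ (j !) ℚ.* 1/j!      ≡⟨ cong (ℚ._* 1/j!) (fromℕ-homo-* n (j !)) ⟨
  fromℕ (n * j !) ℚ.* 1/j!
    ≤⟨ ℚ.*-monoʳ-≤-nonNeg 1/j! {{ℚ.normalize-nonNeg 1 (j !)}} (fromℕ-mono-≤ n*j!≤) ⟩
  fromℕ (y ^ j) ℚ.* 1/j!                ≡⟨ cong (ℚ._* 1/j!) (fromℕ-homo-^ y j) ⟩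
  expTerm (fromℕ y) j                   ∎
  where
  open ℚ.≤-Reasoning
  instance
    j!≢0 : NonZero (j !)
    j!≢0 = j !≢0
  1/j! : ℚ
  1/j! = + 1 / (j !)

expPartialSum-nonNeg : ∀ y i → ℚ.NonNegative (expPartialSum (fromℕ y) i)
expPartialSum-nonNeg y zero    = expTerm-nonNeg y zero
expPartialSum-nonNeg y (suc i) = ℚ.nonNeg+nonNeg⇒nonNeg
  (expPartialSum (fromℕ y) i) {{expPartialSum-nonNeg y i}}
  (expTerm (fromℕ y) (suc i)) {{expTerm-nonNeg y (suc i)}}

-- At a natural argument all terms of the series are nonnegative, so a partial sum dominates each of
-- its terms.
expTerm≤expPartialSum : ∀ y {j i} → j ≤ i → expTerm (fromℕ y) j ℚ.≤ expPartialSum (fromℕ y) i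
expTerm≤expPartialSum y {j} {zero}  z≤n = ℚ.≤-refl
expTerm≤expPartialSum y {j} {suc i} j≤1+i with m≤n⇒m<n∨m≡n j≤1+i
... | inj₁ j<1+i = ℚ.≤-trans (expTerm≤expPartialSum y (s≤s⁻¹ j<1+i))
        (p≤p+q (expPartialSum (fromℕ y) i)
          (ℚ.nonNegative⁻¹ (expTerm (fromℕ y) (suc i)) {{expTerm-nonNeg y (suc i)}}))
... | inj₂ refl  = p≤q+p (expTerm (fromℕ y) (suc i))
        (ℚ.nonNegative⁻¹ (expPartialSum (fromℕ y) i) {{expPartialSum-nonNeg y i}})

-- Each of the `j` factors of `j !` is at most `b`; keeping `b` separate from `j` holds the base
-- fixed during the induction.
q^j*j!≤[q*b]^j : ∀ q {b} j → j ≤ b → q ^ j * j ! ≤ (q * b) ^ j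
q^j*j!≤[q*b]^j q     zero    _   = ≤-refl
q^j*j!≤[q*b]^j q {b} (suc j) j<b = begin
  q * q ^ j * (suc j * j !)     ≡⟨ interchange q (q ^ j) (suc j) (j !) ⟩
  q * suc j * (q ^ j * j !)     ≤⟨ *-mono-≤ (*-monoʳ-≤ q j<b) (q^j*j!≤[q*b]^j q j (<⇒≤ j<b)) ⟩
  q * b * (q * b) ^ j           ∎
  where
  open ≤-Reasoning
  interchange : ∀ a b c d → a * b * (c * d) ≡ a * c * (b * d)
  interchange = ℕSolver.solve-∀

constant : ℚ → ℝ
constant x = record
  { seq    = λ _ → x
  ; cauchy = λ ε 0<ε → 0 , λ _ _ _ _ → subst (λ d → ℚ.∣ d ∣ ℚ.≤ ε) (sym (ℚ.+-inverseʳ x)) (ℚ.<⇒≤ 0<ε)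
  }

constant-positive : ∀ {x} → 0ℚ ℚ.< x → Positive (constant x)
constant-positive 0<x = _ , 0<x , 0 , λ _ _ → ℚ.≤-refl

-- The single term j = l k of the exponential series at x = l q k already
-- dominates, since x ^ j = q ^ j j ^ j ≥ q ^ j j!.
≤exp-bound : ∀ q l k n → n ≤ q ^ (l * k) → n ≤exp[ constant (fromℕ (l * q)) · k ]
≤exp-bound q l k n n≤ ε 0<ε = j , λ i j≤i → begin
  fromℕ n                                              ≤⟨ expTerm-lower-bound y j n n*j!≤y^j ⟩
  expTerm (fromℕ y) j                                  ≤⟨ expTerm≤expPartialSum y j≤i ⟩
  expPartialSum (fromℕ y) i                            ≡⟨ cong (λ x → expPartialSum x i) (fromℕ-homo-* (l * q) k) ⟩
  expPartialSum (fromℕ (l * q) ℚ.* fromℕ k) i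
    ≤⟨ p≤p+q _ (ℚ.<⇒≤ 0<ε) ⟩
  expPartialSum (fromℕ (l * q) ℚ.* fromℕ k) i ℚ.+ ε    ∎
  where
  open ℚ.≤-Reasoning
  j y : ℕ
  j = l * k
  y = l * q * k
  rearrange : ∀ l q k → q * (l * k) ≡ l * q * k
  rearrange = ℕSolver.solve-∀
  n*j!≤y^j : n * j ! ≤ y ^ j
  n*j!≤y^j = ≤-trans (*-monoˡ-≤ (j !) n≤) (≤-trans (q^j*j!≤[q*b]^j q j ≤-refl)
    (≤-reflexive (cong (_^ j) (rearrange l q k))))

-- Multiples with prescribed digit sum and their size

+-sum : ∀ ns → Σ⟨ +_ ⟩ ns ≡ + sum ns
+-sum []       = refl
+-sum (n ∷ ns) = ≡.trans (cong (λ s → + n ℤ.+ s) (+-sum ns)) (sym (ℤ.pos-+ n (sum ns)))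

module _ (q : ℕ) (2≤q : 2 ≤ q) where

  open Base q 2≤q

  candidate-bounded : ∀ k → 1 ≤ k → ∃[ a ] (IsCandidate q 2≤q k a × a ≤ q ^ (3 * k))
  candidate-bounded k@(suc k-1) 1≤k
    -- The `3 * k` powers are two more than the `k + 2 * (k - 1)` required.
    with zeroSum k +_ (iterate (_* q) 1 (3 * k)) (≤-trans (+-monoʳ-≤ k (*-monoʳ-≤ 2 (n≤1+n k-1)))
           (≤-reflexive (sym (length-iterate (_* q) 1 (3 * k)))))
  ... | ys , ys≼ , ys-len , k∣Σ with ≼⇒⊆ ys≼
  ... | ys′ , ys′⊆ , ys′↭ys = sum ys′ , (positive , k∣a , digits) , bound
    where
    digits : digitSum q 2≤q (sum ys′) ≡ k
    digits = ≡.trans (digitSum-subset (3 * k) ys′⊆) (≡.trans (↭-length ys′↭ys) ys-len)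

    -- The empty expansion shows that `0` has digit sum `0`, whereas the digit sum here is `k ≥ 1`.
    positive : 1 ≤ sum ys′
    positive = n≢0⇒n>0 λ a≡0 → <⇒≢ 1≤k
      (≡.trans (sym (digitSum-fromDigits [])) (≡.trans (cong (digitSum q 2≤q) (sym a≡0)) digits))

    k∣a : k ℕ.∣ sum ys′
    k∣a = subst (k ℕ.∣_) (sym (sum-↭ ys′↭ys)) (∣⇒∣ᵤ (subst (+ k ℤ.∣_) (+-sum ys) k∣Σ))

    bound : sum ys′ ≤ q ^ (3 * k)
    bound = ≤-trans (n≤1+n (sum ys′))
      (≤-trans (subset-sum-bound 1 (3 * k) ys′⊆) (≤-reflexive (*-identityˡ (q ^ (3 * k)))))

  candidate? : ∀ k a → Dec (IsCandidate q 2≤q k a)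
  candidate? k a = (1 ≤? a) ×-dec ((k ℕ.∣? a) ×-dec (digitSum q 2≤q a ≟ k))

  -- The factor `3` comes from the bound `q ^ (3 * k)`: `≤exp-bound` with `l = 3` places it below
  -- `exp (3 q k)`.
  rate : ℝ
  rate = constant (fromℕ (3 * q))

  rate-positive : Positive rate
  rate-positive = constant-positive (ℚ.positive⁻¹ (fromℕ (3 * q))
    {{ℚ.normalize-pos (3 * q) 1 {{_}} {{m*n≢0 3 q {{_}} {{>-nonZero (<-trans (s≤s z≤n) 2≤q)}}}}}})

  multiplier : ∀ k → 1 ≤ k →
    ∃[ n ] (1 ≤ n × n ≤exp[ rate · k ] × digitSum q 2≤q (k * n) ≡ k)
  multiplier k 1≤k with candidate-bounded k 1≤k
  -- The multiplier is the quotient of the candidate by `k`, and is no larger than the candidate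
  -- itself.
  ... | .(n * k) , (1≤a , ℕ.divides-refl n , digits) , a≤ =
    n , n≢0⇒n>0 (λ { refl → n≮0 1≤a }) , ≤exp-bound q 3 k n (≤-trans n≤a a≤) ,
    ≡.trans (cong (digitSum q 2≤q) (*-comm k n)) digits
    where
    n≤a : n ≤ n * k
    n≤a = m≤m*n n k {{>-nonZero 1≤k}}

  smallest-multiple : ∀ k → 1 ≤ k → ∃[ a ] (IsSmallestMultiple q 2≤q k a × a ≤exp[ rate · k ])
  smallest-multiple k 1≤k with candidate-bounded k 1≤k
  ... | a , a-candidate , a≤ with least (candidate? k) a a-candidate
  ... | m , m-smallest , m≤a = m , m-smallest , ≤exp-bound q 3 k m (≤-trans m≤a a≤)

mainTheorem14 : (q : ℕ) (2≤q : 2 ≤ q) →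
    (∃[ c₆ ] (Positive c₆ ×
    (∀ k → 1 ≤ k →
    ∃[ n ] (1 ≤ n × n ≤exp[ c₆ · k ] × digitSum q 2≤q (k * n) ≡ k))))
    ×
    (∃[ C ] (Positive C ×
    (∀ k → 1 ≤ k →
    ∃[ a ] (IsSmallestMultiple q 2≤q k a × a ≤exp[ C · k ]))))
mainTheorem14 q 2≤q =
  (rate q 2≤q , rate-positive q 2≤q , multiplier q 2≤q) ,
  (rate q 2≤q , rate-positive q 2≤q , smallest-multiple q 2≤q)
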